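{- For every $n\ge 1$ there is a word over $\mathbb{P}$ (equivalently, a permutation) of length $\lceil (n^2+1)/2\rceil$ that contains, for every permutation $\pi$ of length $n$, a subsequence order-isomorphic to $\pi$.
   Context: $\mathbb{P}$ is the set of positive integers. A permutation of length $n$ is a word containing each letter of $[n]$ exactly once. Words $u,v$ of length $k$ are order-isomorphic if $u(i)>u(j)\iff v(i)>v(j)$ for all $i,j\in[k]$. A word $w$ contains a subsequence order-isomorphic to $\pi$ if there are indices $i_1<\cdots<i_n$ with $w(i_1)\cdots w(i_n)$ order-isomorphic to $\pi$. -}

module Defs where

open import Data.Fin using (Fin) renaming (_<_ to _<ᶠ_)
open import Data.Nat using (ℕ; NonZero; _≤_; _>_)
open import Data.Product using (∃; ∃!; _×_)
open import Data.Refinement using (Refinement; value)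
open import Data.Vec.Functional using (Vector)
open import Function using (_∘_; _⇔_)
open import Relation.Binary.Core using (_Preserves_⟶_)
open import Relation.Binary.PropositionalEquality using (_≡_)

ℙ : Set
ℙ = Refinement ℕ NonZero

Word : ℕ → Set
Word k = Vector ℙ k

-- Together with the length being n, this forces every letter to lie in [n].
IsPermutation : ∀ {n} → Word n → Set
IsPermutation {n} w =
  ∀ (a : ℙ) → value a ≤ n → ∃! _≡_ λ (i : Fin n) → value (w i) ≡ value a

OrderIsomorphic : ∀ {k} → Word k → Word k → Set
OrderIsomorphic {k} u v = ∀ (i j : Fin k) →
  (value (u i) > value (u j)) ⇔ (value (v i) > value (v j))

Contains : ∀ {k n} → Word k → Word n → Set
Contains {k} {n} w π = ∃ λ (ι : Fin n → Fin k) →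
  (ι Preserves _<ᶠ_ ⟶ _<ᶠ_) × OrderIsomorphic (w ∘ ι) π

ContainsAllPermutations : ∀ {k} → ℕ → Word k → Set
ContainsAllPermutations n w = ∀ (π : Word n) → IsPermutation π → Contains w π

{-# OPTIONS --safe #-}
module Submission where

-- Count positions, letters and runs from 0. Let run r < n of the zigzag word list
-- all letters < n of the parity of r, upwards for even r and downwards for odd r;
-- for even n, append one more 0. The permutation is obtained by breaking ties so
-- that later copies of a letter are smaller.
--
-- Embed words greedily. Passing to the next letter costs 1 run if the parity changes
-- and 0 or 2 otherwise, and adding 1 to all letters exchanges the costs 0 and 2, so
-- for a word of length n without consecutive repetitions the last runs used by it
-- and by its shift add up to 2n - 1. If a + 1 precedes a in π, but not immediately,
-- both may be played by the same letter; the resulting word and its shift have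
-- letters < n, and one of them fits into n runs.
--
-- Otherwise π is layered, i.e. a direct sum of decreasing permutations. Place the
-- entry at position p in run p. On layers of odd length the parities agree; a layer
-- of even length has to be moved by one run: later if it starts at an even position,
-- earlier if it starts at an odd one. This exceeds the n runs only if n is even and
-- the last layer has even length. If that layer is all of π, the appended 0 helps;
-- otherwise sharing a letter inside one of the last two layers does.

open import Data.Bool using (T; true; false; if_then_else_)
open import Data.Fin as Fin using (Fin; toℕ; fromℕ<; punchOut)
import Data.Fin.Properties as Fin
open import Data.Irrelevant using ([_])
open import Data.List using (List; []; _∷_; _++_; length; lookup; filter; applyUpTo; applyDownFrom)
open import Data.List.Membership.Propositional using (_∈_)
open import Data.List.Membership.Propositional.Properties
  using (∈-++⁺ˡ; ∈-++⁺ʳ; ∈-applyUpTo⁺; ∈-applyDownFrom⁺; ∈-lookup)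
open import Data.List.Properties
  using (length-++; length-applyUpTo; length-applyDownFrom; filter-notAll)
open import Data.List.Relation.Unary.All as All using (All; []; _∷_)
import Data.List.Relation.Unary.All.Properties as All
open import Data.List.Relation.Unary.AllPairs using (AllPairs; []; _∷_)
import Data.List.Relation.Unary.AllPairs.Properties as AllPairs
open import Data.List.Relation.Unary.Any as Any using (here; there; index)
open import Data.List.Relation.Unary.Any.Properties using (lookup-index)
open import Data.Nat
open import Data.Nat.Properties
open import Data.Nat.Solver using (module +-*-Solver)
open import Data.Parity.Base as ℙ using (Parity; 0ℙ; 1ℙ; _⁻¹)
open import Data.Parity.Properties using (suc-homo-⁻¹; +-homo-+)
open import Data.Product using (∃; _×_; _,_; proj₁; proj₂)
open import Data.Refinement using (_,_; value)
open import Data.Sum using (_⊎_; inj₁; inj₂; [_,_]′)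
open import Function using (_∘_; mk⇔)
open import Function.Definitions using (Injective)
open import Relation.Binary using (tri<; tri≈; tri>; Trichotomous; Transitive)
open import Relation.Binary.PropositionalEquality
open import Relation.Nullary using (¬_; Dec; yes; no; contradiction)
open import Relation.Nullary.Decidable using (_⊎-dec_; _×-dec_)
open import Relation.Unary using (Decidable)
open import Defs

-- Cells of the zigzag and their two orders

Cell : Set
Cell = ℕ × ℕ

run letter : Cell → ℕ
run    = proj₁
letter = proj₂

Ascends : Parity → ℕ → ℕ → Set
Ascends 0ℙ v w = v < w
Ascends 1ℙ v w = w < v

infix 4 _◁_ _≺_ _≺?_

-- The order of occurrence in the zigzag word: by run, and inside a run in the direction of that
-- run.
_◁_ : Cell → Cell → Set
(r , v) ◁ (s , w) = r < s ⊎ (r ≡ s × Ascends (parity r) v w)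

-- Copies of one letter count as smaller the later they occur.
_≺_ : Cell → Cell → Set
(r , v) ≺ (s , w) = v < w ⊎ (v ≡ w × s < r)

_≺?_ : ∀ x y → Dec (x ≺ y)
(r , v) ≺? (s , w) = (v <? w) ⊎-dec ((v ≟ w) ×-dec (s <? r))

Ascends-trans : ∀ p {u v w} → Ascends p u v → Ascends p v w → Ascends p u w
Ascends-trans 0ℙ a b = <-trans a b
Ascends-trans 1ℙ a b = <-trans b a

Ascends-irrefl : ∀ p {v} → ¬ Ascends p v v
Ascends-irrefl 0ℙ = <-irrefl refl
Ascends-irrefl 1ℙ = <-irrefl refl

◁-trans : ∀ {x y z} → x ◁ y → y ◁ z → x ◁ z
◁-trans (inj₁ a)          (inj₁ b)          = inj₁ (<-trans a b)
◁-trans (inj₁ a)          (inj₂ (refl , _)) = inj₁ a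
◁-trans (inj₂ (refl , _)) (inj₁ b)          = inj₁ b
◁-trans {r , _} (inj₂ (refl , a)) (inj₂ (refl , b)) =
  inj₂ (refl , Ascends-trans (parity r) a b)

◁-irrefl : ∀ {x} → ¬ x ◁ x
◁-irrefl         (inj₁ a)       = <-irrefl refl a
◁-irrefl {r , _} (inj₂ (_ , a)) = Ascends-irrefl (parity r) a

◁⇒run≤ : ∀ {x y} → x ◁ y → run x ≤ run y
◁⇒run≤ (inj₁ a)          = <⇒≤ a
◁⇒run≤ (inj₂ (refl , _)) = ≤-refl

-- A run is strictly monotone and so holds each letter at most once; copies of a letter are told
-- apart by their runs.
◁-sameLetter : ∀ {x y} → letter x ≡ letter y → x ◁ y → run x < run y
◁-sameLetter _    (inj₁ a)          = a
◁-sameLetter {r , _} refl (inj₂ (_ , a)) = contradiction a (Ascends-irrefl (parity r))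

≺-trans : ∀ {x y z} → x ≺ y → y ≺ z → x ≺ z
≺-trans (inj₁ a)          (inj₁ b)          = inj₁ (<-trans a b)
≺-trans (inj₁ a)          (inj₂ (refl , _)) = inj₁ a
≺-trans (inj₂ (refl , _)) (inj₁ b)          = inj₁ b
≺-trans (inj₂ (refl , a)) (inj₂ (refl , b)) = inj₂ (refl , <-trans b a)

≺-irrefl : ∀ {x} → ¬ x ≺ x
≺-irrefl (inj₁ a)       = <-irrefl refl a
≺-irrefl (inj₂ (_ , a)) = <-irrefl refl a

≺-cmp : Trichotomous _≡_ _≺_
≺-cmp (r , v) (s , w) with <-cmp v w
... | tri< a ≢ ≯ = tri< (inj₁ a) (λ { refl → ≢ refl }) λ { (inj₁ b) → ≯ b ; (inj₂ (e , _)) → ≢ (sym e) }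
... | tri> ≮ ≢ a = tri> (λ { (inj₁ b) → ≮ b ; (inj₂ (e , _)) → ≢ e }) (λ { refl → ≢ refl }) (inj₁ a)
... | tri≈ _ refl _ with <-cmp s r
...   | tri< a ≢ ≯ = tri< (inj₂ (refl , a)) (λ { refl → ≢ refl })
                          λ { (inj₁ b) → <-irrefl refl b ; (inj₂ (_ , b)) → ≯ b }
...   | tri≈ _ refl _ = tri≈ ≺-irrefl refl ≺-irrefl
...   | tri> ≮ ≢ a = tri> (λ { (inj₁ b) → <-irrefl refl b ; (inj₂ (_ , b)) → ≮ b })
                          (λ { refl → ≢ refl }) (inj₂ (refl , a))

-- The zigzag word

halve : ∀ n → ∃ λ h → (parity n ≡ 0ℙ × n ≡ h + h) ⊎ (parity n ≡ 1ℙ × n ≡ suc (h + h))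
halve 0 = 0 , inj₁ (refl , refl)
halve 1 = 0 , inj₂ (refl , refl)
halve (suc (suc n)) with halve n
... | h , inj₁ (p , e) = suc h , inj₁ (p , cong suc (trans (cong suc e) (sym (+-suc h h))))
... | h , inj₂ (p , e) = suc h , inj₂ (p , cong (suc ∘ suc) (trans e (sym (+-suc h h))))

-- The parity is an argument of its own, so that rewriting with a known parity makes the row
-- compute.
rowOf : Parity → ℕ → ℕ → List Cell
rowOf 0ℙ n r = applyUpTo (λ i → r , i + i) ⌈ n /2⌉
rowOf 1ℙ n r = applyDownFrom (λ i → r , suc (i + i)) ⌊ n /2⌋

rows : ℕ → ℕ → List Cell
rows n zero    = []
rows n (suc m) = rows n m ++ rowOf (parity m) n m

extraCell : Parity → ℕ → List Cell
extraCell 0ℙ n = (n , 0) ∷ []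
extraCell 1ℙ n = []

zigzag : ℕ → List Cell
zigzag n = rows n n ++ extraCell (parity n) n

length-rowOf-0ℙ : ∀ n r → length (rowOf 0ℙ n r) ≡ ⌈ n /2⌉
length-rowOf-0ℙ n r = length-applyUpTo (λ i → r , i + i) ⌈ n /2⌉

length-rowOf-1ℙ : ∀ n r → length (rowOf 1ℙ n r) ≡ ⌊ n /2⌋
length-rowOf-1ℙ n r = length-applyDownFrom (λ i → r , suc (i + i)) ⌊ n /2⌋

parity-double : ∀ h → parity (h + h) ≡ 0ℙ
parity-double zero    = refl
parity-double (suc h) = trans (cong (parity ∘ suc) (+-suc h h)) (parity-double h)

parity-suc : ∀ n → parity (suc n) ≡ parity n ⁻¹
parity-suc zero          = refl
parity-suc (suc zero)    = refl
parity-suc (suc (suc n)) = parity-suc n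

-- An even run and the odd run after it together contain each of the `n` letters once.
length-rows : ∀ n h → length (rows n (h + h)) ≡ h * n
length-rows n zero = refl
length-rows n (suc h) rewrite +-suc h h | parity-suc (h + h) | parity-double h
  | length-++ (rows n (h + h) ++ rowOf 0ℙ n (h + h)) {rowOf 1ℙ n (suc (h + h))}
  | length-++ (rows n (h + h)) {rowOf 0ℙ n (h + h)}
  | length-rowOf-0ℙ n (h + h) | length-rowOf-1ℙ n (suc (h + h)) | length-rows n h = begin
  h * n + ⌈ n /2⌉ + ⌊ n /2⌋   ≡⟨ +-assoc (h * n) _ _ ⟩
  h * n + (⌈ n /2⌉ + ⌊ n /2⌋) ≡⟨ +-comm (h * n) _ ⟩
  ⌈ n /2⌉ + ⌊ n /2⌋ + h * n   ≡⟨ cong (_+ h * n) (trans (+-comm ⌈ n /2⌉ _) (⌊n/2⌋+⌈n/2⌉≡n n)) ⟩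
  n + h * n                   ∎
  where open ≡-Reasoning

-- For n = 2h the runs have 2h² cells and the appended 0 is one more; for n = 2h + 1 the last, even
-- run adds h + 1 cells to h n. Twice these lengths are n² + 2 and n² + 1.
length-zigzag : ∀ n → length (zigzag n) ≡ ⌈ n ^ 2 + 1 /2⌉
length-zigzag n with halve n
... | h , inj₁ (p , refl) rewrite p
  | length-++ (rows (h + h) (h + h)) {(h + h , 0) ∷ []} | length-rows (h + h) h = begin
  h * (h + h) + 1                 ≡⟨ +-comm (h * (h + h)) 1 ⟩
  suc m                           ≡⟨ cong suc (n≡⌊n+n/2⌋ m) ⟩
  ⌈ suc (m + m) /2⌉               ≡⟨ cong ⌈_/2⌉ (solve 1 (λ h → con 1 :+ (h :* (h :+ h) :+ h :* (h :+ h))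
                                       := (h :+ h) :* ((h :+ h) :* con 1) :+ con 1) refl h) ⟩
  ⌈ (h + h) ^ 2 + 1 /2⌉           ∎
  where open ≡-Reasoning
        open +-*-Solver
        m = h * (h + h)
... | h , inj₂ (p , refl) rewrite p | parity-double h
  | length-++ (rows (suc (h + h)) (h + h) ++ rowOf 0ℙ (suc (h + h)) (h + h)) {[]}
  | length-++ (rows (suc (h + h)) (h + h)) {rowOf 0ℙ (suc (h + h)) (h + h)}
  | length-rowOf-0ℙ (suc (h + h)) (h + h) | length-rows (suc (h + h)) h = begin
  h * suc (h + h) + suc ⌊ h + h /2⌋ + 0  ≡⟨ +-identityʳ _ ⟩
  h * suc (h + h) + suc ⌊ h + h /2⌋      ≡⟨ cong (λ k → h * suc (h + h) + suc k) (sym (n≡⌊n+n/2⌋ h)) ⟩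
  m                                      ≡⟨ n≡⌈n+n/2⌉ m ⟩
  ⌈ m + m /2⌉                            ≡⟨ cong ⌈_/2⌉ (solve 1 (λ h →
       (h :* (con 1 :+ (h :+ h)) :+ (con 1 :+ h)) :+ (h :* (con 1 :+ (h :+ h)) :+ (con 1 :+ h))
         := (con 1 :+ (h :+ h)) :* ((con 1 :+ (h :+ h)) :* con 1) :+ con 1) refl h) ⟩
  ⌈ suc (h + h) ^ 2 + 1 /2⌉              ∎
  where open ≡-Reasoning
        open +-*-Solver
        m = h * suc (h + h) + suc h

rowOf-run : ∀ p n r → All (λ x → run x ≡ r) (rowOf p n r)
rowOf-run 0ℙ n r = All.applyUpTo⁺₂ _ _ (λ _ → refl)
rowOf-run 1ℙ n r = All.applyDownFrom⁺₂ _ _ (λ _ → refl)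

rowOf-sorted : ∀ p n r → parity r ≡ p → AllPairs _◁_ (rowOf p n r)
rowOf-sorted 0ℙ n r e = AllPairs.applyUpTo⁺₁ _ _ λ i<j _ →
  inj₂ (refl , subst (λ p → Ascends p _ _) (sym e) (+-mono-< i<j i<j))
rowOf-sorted 1ℙ n r e = AllPairs.applyDownFrom⁺₁ _ _ λ j<i _ →
  inj₂ (refl , subst (λ p → Ascends p _ _) (sym e) (s<s (+-mono-< j<i j<i)))

rows-run : ∀ n m → All (λ x → run x < m) (rows n m)
rows-run n zero    = []
rows-run n (suc m) = All.++⁺ (All.map m<n⇒m<1+n (rows-run n m))
  (All.map (λ { refl → ≤-refl }) (rowOf-run (parity m) n m))

++-sorted : ∀ {xs ys m} → AllPairs _◁_ xs → AllPairs _◁_ ys →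
  All (λ x → run x < m) xs → All (λ y → run y ≡ m) ys → AllPairs _◁_ (xs ++ ys)
++-sorted xs↗ ys↗ xs<m ys≡m =
  AllPairs.++⁺ xs↗ ys↗ (All.map (λ x<m → All.map (λ { refl → inj₁ x<m }) ys≡m) xs<m)

rows-sorted : ∀ n m → AllPairs _◁_ (rows n m)
rows-sorted n zero    = []
rows-sorted n (suc m) = ++-sorted (rows-sorted n m) (rowOf-sorted _ n m refl)
  (rows-run n m) (rowOf-run (parity m) n m)

zigzag-sorted : ∀ n → AllPairs _◁_ (zigzag n)
zigzag-sorted n with parity n
... | 0ℙ = ++-sorted (rows-sorted n n) ([] ∷ []) (rows-run n n) (refl ∷ [])
... | 1ℙ = ++-sorted (rows-sorted n n) [] (rows-run n n) []

∈-rowOf : ∀ n r v → parity r ≡ parity v → v < n → (r , v) ∈ rowOf (parity r) n r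
∈-rowOf n r v e v<n rewrite e with halve v
... | h , inj₁ (p , refl) rewrite p = ∈-applyUpTo⁺ _
        (subst (_< ⌈ n /2⌉) (sym (n≡⌊n+n/2⌋ h)) (⌈n/2⌉-mono v<n))
... | h , inj₂ (p , refl) rewrite p = ∈-applyDownFrom⁺ _
        (subst (_< ⌊ n /2⌋) (sym (n≡⌊n+n/2⌋ h)) (⌊n/2⌋-mono v<n))

∈-rows : ∀ n m {r v} → parity r ≡ parity v → r < m → v < n → (r , v) ∈ rows n m
∈-rows n (suc m) {r} e r<1+m v<n with m≤n⇒m<n∨m≡n (s≤s⁻¹ r<1+m)
... | inj₁ r<m  = ∈-++⁺ˡ (∈-rows n m e r<m v<n)
... | inj₂ refl = ∈-++⁺ʳ (rows n m) (∈-rowOf n r _ e v<n)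

∈-zigzag : ∀ n {r v} → parity r ≡ parity v → r < n → v < n → (r , v) ∈ zigzag n
∈-zigzag n e r<n v<n = ∈-++⁺ˡ (∈-rows n n e r<n v<n)

extra∈zigzag : ∀ n → parity n ≡ 0ℙ → (n , 0) ∈ zigzag n
extra∈zigzag n e rewrite e = ∈-++⁺ʳ (rows n n) (here refl)

-- Standardisation

module _ {A : Set} {P Q : A → Set} (P? : Decidable P) (Q? : Decidable Q) (P⇒Q : ∀ {x} → P x → Q x) where

  length-filter-mono-≤ : ∀ xs → length (filter P? xs) ≤ length (filter Q? xs)
  length-filter-mono-≤ [] = z≤n
  length-filter-mono-≤ (x ∷ xs) with P? x | Q? x
  ... | yes p | yes q = s≤s (length-filter-mono-≤ xs)
  ... | yes p | no ¬q = contradiction (P⇒Q p) ¬q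
  ... | no ¬p | yes q = m≤n⇒m≤1+n (length-filter-mono-≤ xs)
  ... | no ¬p | no ¬q = length-filter-mono-≤ xs

  length-filter-mono-< : ∀ {x xs} → x ∈ xs → ¬ P x → Q x →
    length (filter P? xs) < length (filter Q? xs)
  length-filter-mono-< {x} {_ ∷ xs} (here refl) ¬p q with P? x | Q? x
  ... | yes p | _     = contradiction p ¬p
  ... | no _  | yes _ = s≤s (length-filter-mono-≤ xs)
  ... | no _  | no ¬q = contradiction q ¬q
  length-filter-mono-< {x} {y ∷ xs} (there i) ¬p q with P? y | Q? y
  ... | yes p | yes q′ = s≤s (length-filter-mono-< i ¬p q)
  ... | yes p | no ¬q  = contradiction (P⇒Q p) ¬q
  ... | no _  | yes _  = m≤n⇒m≤1+n (length-filter-mono-< i ¬p q)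
  ... | no _  | no _   = length-filter-mono-< i ¬p q

-- If `y` were missed, punching it out of the codomain would leave an injection into a smaller
-- `Fin`.
injective⇒surjective : ∀ {n} (f : Fin n → Fin n) → Injective _≡_ _≡_ f → ∀ y → ∃ λ x → f x ≡ y
injective⇒surjective {suc n} f inj y with Fin.any? (λ x → f x Fin.≟ y)
... | yes hit  = hit
... | no  miss = contradiction
  (λ {i} {j} e → inj (Fin.punchOut-injective {i = y} (λ y≡ → miss (i , sym y≡)) (λ y≡ → miss (j , sym y≡)) e))
  (Fin.<⇒notInjective {f = λ x → punchOut {i = y} (λ y≡ → miss (x , sym y≡))} ≤-refl)

AllPairs-lookup : ∀ {A : Set} {R : A → A → Set} {xs} → AllPairs R xs →
  ∀ {i j : Fin (length xs)} → i Fin.< j → R (lookup xs i) (lookup xs j)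
AllPairs-lookup (px ∷ _)  {Fin.zero}  {Fin.suc j} _         = All.lookup px (∈-lookup j)
AllPairs-lookup (_ ∷ pxs) {Fin.suc i} {Fin.suc j} (s≤s i<j) = AllPairs-lookup pxs i<j

module Standardisation (xs : List Cell) (xs↗ : AllPairs _◁_ xs) where

  rank : Cell → ℕ
  rank x = length (filter (_≺? x) xs)

  -- Everything below `x` is below `y`, and `x` itself is counted for `y` but not for `x`.
  rank-mono : ∀ {x y} → x ∈ xs → x ≺ y → rank x < rank y
  rank-mono {x} {y} x∈xs x≺y =
    length-filter-mono-< (_≺? x) (_≺? y) (λ z≺x → ≺-trans z≺x x≺y) x∈xs ≺-irrefl x≺y

  rank-cancel : ∀ {x y} → y ∈ xs → rank x < rank y → x ≺ y
  rank-cancel {x} {y} y∈xs lt with ≺-cmp x y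
  ... | tri< x≺y _ _  = x≺y
  ... | tri≈ _ refl _ = contradiction lt (<-irrefl refl)
  ... | tri> _ _ y≺x  = contradiction lt (<-asym (rank-mono y∈xs y≺x))

  rank-injective : ∀ {x y} → x ∈ xs → y ∈ xs → rank x ≡ rank y → x ≡ y
  rank-injective {x} {y} x∈xs y∈xs e with ≺-cmp x y
  ... | tri< x≺y _ _ = contradiction e (<⇒≢ (rank-mono x∈xs x≺y))
  ... | tri≈ _ x≡y _ = x≡y
  ... | tri> _ _ y≺x = contradiction (sym e) (<⇒≢ (rank-mono y∈xs y≺x))

  rank-bounded : ∀ {x} → x ∈ xs → rank x < length xs
  rank-bounded {x} x∈xs = filter-notAll (_≺? x) xs (Any.map (λ { refl → ≺-irrefl }) x∈xs)

  lookup-injective : ∀ {i j} → lookup xs i ≡ lookup xs j → i ≡ j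
  lookup-injective {i} {j} e with Fin.<-cmp i j
  ... | tri< i<j _ _ = contradiction (subst (_◁ lookup xs j) e (AllPairs-lookup xs↗ i<j)) ◁-irrefl
  ... | tri≈ _ i≡j _ = i≡j
  ... | tri> _ _ j<i = contradiction (subst (lookup xs j ◁_) e (AllPairs-lookup xs↗ j<i)) ◁-irrefl

  index-mono : ∀ {x y} (x∈xs : x ∈ xs) (y∈xs : y ∈ xs) → x ◁ y → index x∈xs Fin.< index y∈xs
  index-mono {x} {y} x∈xs y∈xs x◁y with Fin.<-cmp (index x∈xs) (index y∈xs)
  ... | tri< i<j _ _ = i<j
  ... | tri≈ _ i≡j _ = contradiction
    (subst (_◁ y) (trans (lookup-index x∈xs) (trans (cong (lookup xs) i≡j) (sym (lookup-index y∈xs)))) x◁y)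
    ◁-irrefl
  ... | tri> _ _ j<i = contradiction
    (◁-trans x◁y (subst₂ _◁_ (sym (lookup-index y∈xs)) (sym (lookup-index x∈xs)) (AllPairs-lookup xs↗ j<i)))
    ◁-irrefl

  std : Word (length xs)
  std i = suc (rank (lookup xs i)) , [ _ ]

  -- Ranks are distinct and below the length of `xs`, hence by finiteness they take every value
  -- below it.
  std-isPermutation : IsPermutation std
  std-isPermutation (zero  , [ () ])
  std-isPermutation (suc a , _) a≤k with injective⇒surjective rankᶠ rankᶠ-injective (fromℕ< a≤k)
    where
    rankᶠ : Fin (length xs) → Fin (length xs)
    rankᶠ i = fromℕ< (rank-bounded (∈-lookup i))

    rankᶠ-injective : Injective _≡_ _≡_ rankᶠ
    rankᶠ-injective {i} {j} e = lookup-injective (rank-injective (∈-lookup i) (∈-lookup j)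
      (Fin.fromℕ<-injective _ _ (rank-bounded (∈-lookup i)) (rank-bounded (∈-lookup j)) e))
  ... | i , e = i , cong suc rank≡a , λ {j} e′ → lookup-injective
      (rank-injective (∈-lookup i) (∈-lookup j) (trans rank≡a (sym (suc-injective e′))))
    where
    rank≡a : rank (lookup xs i) ≡ a
    rank≡a = Fin.fromℕ<-injective _ _ (rank-bounded (∈-lookup i)) a≤k e

-- With this, the order conditions on an embedding need checking only at consecutive positions and
-- at consecutive letters.
step⇒mono : ∀ {A : Set} {R : A → A → Set} → Transitive R → ∀ {n} (f : ℕ → A) →
  (∀ {p} → suc p < n → R (f p) (f (suc p))) → ∀ {p q} → p < q → q < n → R (f p) (f q)
step⇒mono {R = R} R-trans {n} f step {p} {suc q} (s≤s p≤q) q<n with m≤n⇒m<n∨m≡n p≤q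
... | inj₁ p<q  = R-trans (step⇒mono {R = R} R-trans f step p<q (<-trans (n<1+n q) q<n)) (step q<n)
... | inj₂ refl = step q<n

-- Permutations and their embeddings

-- Positions and letters are plain naturals counted from 0, which keeps the arithmetic free of
-- `Fin`. The laws constrain only arguments below `n`.
record Perm (n : ℕ) : Set where
  field
    at     : ℕ → ℕ
    pos    : ℕ → ℕ
    at<    : ∀ {p} → p < n → at p < n
    pos<   : ∀ {a} → a < n → pos a < n
    at-pos : ∀ {a} → a < n → at (pos a) ≡ a
    pos-at : ∀ {p} → p < n → pos (at p) ≡ p

-- Occurrence in the zigzag has to follow the positions of π, and size, with ties broken, its
-- letters.
record Embedding {n} (π : Perm n) : Set where
  open Perm π
  field
    cell   : ℕ → Cell
    inGrid : ∀ {p} → p < n → cell p ∈ zigzag n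
    ◁-step : ∀ {p} → suc p < n → cell p ◁ cell (suc p)
    ≺-step : ∀ {a} → suc a < n → cell (pos a) ≺ cell (pos (suc a))

extend : ∀ {n} → (Fin n → ℕ) → ℕ → ℕ
extend {n} f p with p <? n
... | yes p<n = f (fromℕ< p<n)
... | no  _   = 0

extend-toℕ : ∀ {n} (f : Fin n → ℕ) i → extend f (toℕ i) ≡ f i
extend-toℕ {n} f i with toℕ i <? n
... | yes i<n = cong f (Fin.fromℕ<-toℕ i i<n)
... | no  i≮n = contradiction (Fin.toℕ<n i) i≮n

∀<-by-Fin : ∀ {n} (P : ℕ → Set) → (∀ (i : Fin n) → P (toℕ i)) → ∀ {p} → p < n → P p
∀<-by-Fin P P-toℕ p<n = subst P (Fin.toℕ-fromℕ< p<n) (P-toℕ (fromℕ< p<n))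

module FromWord {n} (π : Word n) (π-perm : IsPermutation π) where

  posᶠ : Fin n → Fin n
  posᶠ a = proj₁ (π-perm (suc (toℕ a) , [ _ ]) (Fin.toℕ<n a))

  value-posᶠ : ∀ a → value (π (posᶠ a)) ≡ suc (toℕ a)
  value-posᶠ a = proj₁ (proj₂ (π-perm (suc (toℕ a) , [ _ ]) (Fin.toℕ<n a)))

  posᶠ-injective : Injective _≡_ _≡_ posᶠ
  posᶠ-injective {a} {b} e = Fin.toℕ-injective (suc-injective
    (trans (sym (value-posᶠ a)) (trans (cong (value ∘ π) e) (value-posᶠ b))))

  -- `IsPermutation` only locates given letters. That every position carries a letter of [n] follows
  -- because `posᶠ` is injective, hence surjective.
  atᶠ : Fin n → Fin n
  atᶠ i = proj₁ (injective⇒surjective posᶠ posᶠ-injective i)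

  posᶠ-atᶠ : ∀ i → posᶠ (atᶠ i) ≡ i
  posᶠ-atᶠ i = proj₂ (injective⇒surjective posᶠ posᶠ-injective i)

  value-π : ∀ i → value (π i) ≡ suc (toℕ (atᶠ i))
  value-π i = trans (cong (value ∘ π) (sym (posᶠ-atᶠ i))) (value-posᶠ (atᶠ i))

  at pos : ℕ → ℕ
  at  = extend (toℕ ∘ atᶠ)
  pos = extend (toℕ ∘ posᶠ)

  at-toℕ : ∀ i → at (toℕ i) ≡ toℕ (atᶠ i)
  at-toℕ = extend-toℕ (toℕ ∘ atᶠ)

  pos-toℕ : ∀ i → pos (toℕ i) ≡ toℕ (posᶠ i)
  pos-toℕ = extend-toℕ (toℕ ∘ posᶠ)

  perm : Perm n
  perm = record
    { at     = at
    ; pos    = pos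
    ; at<    = ∀<-by-Fin (λ p → at p < n) λ i → subst (_< n) (sym (at-toℕ i)) (Fin.toℕ<n (atᶠ i))
    ; pos<   = ∀<-by-Fin (λ a → pos a < n) λ i → subst (_< n) (sym (pos-toℕ i)) (Fin.toℕ<n (posᶠ i))
    ; at-pos = ∀<-by-Fin (λ a → at (pos a) ≡ a) λ i →
        trans (cong at (pos-toℕ i)) (trans (at-toℕ (posᶠ i)) (cong toℕ (posᶠ-injective (posᶠ-atᶠ (posᶠ i)))))
    ; pos-at = ∀<-by-Fin (λ p → pos (at p) ≡ p) λ i →
        trans (cong pos (at-toℕ i)) (trans (pos-toℕ (atᶠ i)) (cong toℕ (posᶠ-atᶠ i)))
    }

  module _ (E : Embedding perm) where
    open Embedding E
    open Standardisation (zigzag n) (zigzag-sorted n)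

    mem : ∀ i → cell (toℕ i) ∈ zigzag n
    mem i = inGrid (Fin.toℕ<n i)

    lookup-mem : ∀ i → lookup (zigzag n) (index (mem i)) ≡ cell (toℕ i)
    lookup-mem i = sym (lookup-index (mem i))

    ≺-mono : ∀ {i j} → value (π i) < value (π j) → cell (toℕ i) ≺ cell (toℕ j)
    ≺-mono {i} {j} lt = subst₂ (λ p q → cell p ≺ cell q) (pos-atᶠ i) (pos-atᶠ j)
      (step⇒mono {R = _≺_} ≺-trans {n} (cell ∘ pos) ≺-step
        (s<s⁻¹ (subst₂ _<_ (value-π i) (value-π j) lt)) (Fin.toℕ<n (atᶠ j)))
      where
      pos-atᶠ : ∀ i → pos (toℕ (atᶠ i)) ≡ toℕ i
      pos-atᶠ i = trans (pos-toℕ (atᶠ i)) (cong toℕ (posᶠ-atᶠ i))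

    ≺-cancel : ∀ {i j} → cell (toℕ i) ≺ cell (toℕ j) → value (π i) < value (π j)
    ≺-cancel {i} {j} i≺j with <-cmp (value (π i)) (value (π j))
    ... | tri< lt _ _ = lt
    ... | tri> _ _ gt = contradiction (≺-trans i≺j (≺-mono gt)) ≺-irrefl
    ... | tri≈ _ e _  = contradiction (subst (λ k → cell (toℕ i) ≺ cell (toℕ k)) (sym i≡j) i≺j) ≺-irrefl
      where
      i≡j : i ≡ j
      i≡j = trans (sym (posᶠ-atᶠ i)) (trans (cong posᶠ (Fin.toℕ-injective (suc-injective
              (trans (sym (value-π i)) (trans e (value-π j)))))) (posᶠ-atᶠ j))

    contains : Contains std π
    contains = (λ i → index (mem i))
      , (λ {i} {j} i<j → index-mono (mem i) (mem j)
           (step⇒mono {R = _◁_} ◁-trans cell ◁-step i<j (Fin.toℕ<n j)))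
      , λ i j → mk⇔
          (λ gt → ≺-cancel (rank-cancel (mem i)
            (subst₂ (λ x y → rank x < rank y) (lookup-mem j) (lookup-mem i) (s<s⁻¹ gt))))
          (λ gt → s<s (subst₂ (λ x y → rank x < rank y) (sym (lookup-mem j)) (sym (lookup-mem i))
            (rank-mono (mem j) (≺-mono gt))))

-- Greedy embeddings

-- The cost between two even letters: none if the ascending run still reaches `w`, otherwise the
-- next even run has to be awaited.
asc : ℕ → ℕ → ℕ
asc v w = if v <ᵇ w then 0 else 2

asc-< : ∀ {v w} → v < w → asc v w ≡ 0
asc-< {v} {w} lt with v <ᵇ w | <⇒<ᵇ lt
... | true | _ = refl

asc-≮ : ∀ {v w} → ¬ v < w → asc v w ≡ 2
asc-≮ {v} {w} ≮ with v <ᵇ w in e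
... | false = refl
... | true  = contradiction (<ᵇ⇒< v w (subst T (sym e) _)) ≮

-- The number of runs from `v` to the next `w`, given their parities. Odd runs descend, hence the
-- exchanged arguments of `asc`.
delay : Parity → Parity → ℕ → ℕ → ℕ
delay 0ℙ 0ℙ v w = asc v w
delay 1ℙ 1ℙ v w = asc w v
delay 0ℙ 1ℙ v w = 1
delay 1ℙ 0ℙ v w = 1

asc+asc : ∀ {v w} → v ≢ w → asc v w + asc w v ≡ 2
asc+asc {v} {w} v≢w with <-cmp v w
... | tri< lt _ ≯ = cong₂ _+_ (asc-< lt) (asc-≮ ≯)
... | tri≈ _ e _  = contradiction e v≢w
... | tri> ≮ _ gt = cong₂ _+_ (asc-≮ ≮) (asc-< gt)

-- The shift flips both parities and thus the direction of the runs, but not the comparison of `v`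
-- and `w`: costs 0 and 2 change places and a cost 1 stays. Equal letters would cost 2 both times.
delay+delay : ∀ p q {v w} → v ≢ w → delay p q v w + delay (p ⁻¹) (q ⁻¹) (suc v) (suc w) ≡ 2
delay+delay 0ℙ 0ℙ v≢w = asc+asc v≢w
delay+delay 1ℙ 1ℙ v≢w = asc+asc (v≢w ∘ sym)
delay+delay 0ℙ 1ℙ _ = refl
delay+delay 1ℙ 0ℙ _ = refl

parity-+2 : ∀ r → parity (r + 2) ≡ parity r
parity-+2 r = cong parity (+-comm r 2)

parity-+1 : ∀ r → parity (r + 1) ≡ parity r ⁻¹
parity-+1 r = trans (cong parity (+-comm r 1)) (parity-suc r)

infixl 6 _⊕_
_⊕_ : Cell → ℕ → Cell
(r , v) ⊕ w = r + delay (parity v) (parity w) v w , w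

⊕-step : ∀ r v w → parity r ≡ parity v →
  (r , v) ◁ (r , v) ⊕ w × parity (run ((r , v) ⊕ w)) ≡ parity w
⊕-step r v w e with parity v | parity w
... | 0ℙ | 1ℙ = inj₁ (m<m+n r z<s) , trans (parity-+1 r) (cong _⁻¹ e)
... | 1ℙ | 0ℙ = inj₁ (m<m+n r z<s) , trans (parity-+1 r) (cong _⁻¹ e)
... | 0ℙ | 0ℙ with v <? w
...   | yes lt rewrite asc-< lt | +-identityʳ r = inj₂ (refl , subst (λ p → Ascends p v w) (sym e) lt) , e
...   | no  ≮  rewrite asc-≮ ≮ = inj₁ (m<m+n r z<s) , trans (parity-+2 r) e
⊕-step r v w e | 1ℙ | 1ℙ with w <? v
...   | yes lt rewrite asc-< lt | +-identityʳ r = inj₂ (refl , subst (λ p → Ascends p v w) (sym e) lt) , e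
...   | no  ≮  rewrite asc-≮ ≮ = inj₁ (m<m+n r z<s) , trans (parity-+2 r) e

first : ℕ → Cell
first v = firstRun (parity v) , v
  where
  firstRun : Parity → ℕ
  firstRun 0ℙ = 0
  firstRun 1ℙ = 1

first-parity : ∀ v → parity (run (first v)) ≡ parity v
first-parity v with parity v
... | 0ℙ = refl
... | 1ℙ = refl

first+first : ∀ v → run (first v) + run (first (suc v)) ≡ 1
first+first v rewrite parity-suc v with parity v
... | 0ℙ = refl
... | 1ℙ = refl

greedy : (ℕ → ℕ) → ℕ → Cell
greedy w zero    = first (w zero)
greedy w (suc p) = greedy w p ⊕ w (suc p)

greedy-letter : ∀ w p → letter (greedy w p) ≡ w p
greedy-letter w zero    = refl
greedy-letter w (suc p) = refl

greedy-parity : ∀ w p → parity (run (greedy w p)) ≡ parity (letter (greedy w p))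
greedy-parity w zero    = first-parity (w zero)
greedy-parity w (suc p) = proj₂ (⊕-step (run (greedy w p)) (letter (greedy w p)) (w (suc p)) (greedy-parity w p))

greedy-◁ : ∀ w p → greedy w p ◁ greedy w (suc p)
greedy-◁ w p = proj₁ (⊕-step (run (greedy w p)) (letter (greedy w p)) (w (suc p)) (greedy-parity w p))

-- The two first letters contribute 1, because one of them is even and the other odd; each of the
-- `m` steps contributes 2.
greedy+greedy : ∀ w m → (∀ {p} → p < m → w p ≢ w (suc p)) →
  run (greedy w m) + run (greedy (suc ∘ w) m) ≡ suc (m + m)
greedy+greedy w zero    _    = first+first (w zero)
greedy+greedy w (suc m) w-no
  rewrite greedy-letter w m | greedy-letter (suc ∘ w) m
        | parity-suc (w m) | parity-suc (w (suc m)) = begin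
  (R + d) + (R′ + d′)   ≡⟨ solve 4 (λ a b c d → (a :+ b) :+ (c :+ d) := (a :+ c) :+ (b :+ d)) refl R d R′ d′ ⟩
  (R + R′) + (d + d′)   ≡⟨ cong₂ _+_ (greedy+greedy w m (w-no ∘ m<n⇒m<1+n))
                                   (delay+delay (parity (w m)) (parity (w (suc m))) (w-no ≤-refl)) ⟩
  suc (m + m) + 2       ≡⟨ solve 1 (λ m → con 1 :+ (m :+ m) :+ con 2 := con 1 :+ ((con 1 :+ m) :+ (con 1 :+ m))) refl m ⟩
  suc (suc m + suc m)   ∎
  where
  open ≡-Reasoning
  open +-*-Solver
  R  = run (greedy w m)
  R′ = run (greedy (suc ∘ w) m)
  d  = delay (parity (w m)) (parity (w (suc m))) (w m) (w (suc m))
  d′ = delay (parity (w m) ⁻¹) (parity (w (suc m)) ⁻¹) (suc (w m)) (suc (w (suc m)))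

PlaysBelow : ∀ {n} → Perm n → (ℕ → ℕ) → ℕ → ℕ → Set
PlaysBelow π w a b = w (pos a) < w (pos b) ⊎ (w (pos a) ≡ w (pos b) × pos b < pos a)
  where open Perm π

module Greedy {n} (π : Perm n) (w : ℕ → ℕ)
  (w< : ∀ {p} → p < n → w p < n)
  (w-step : ∀ {a} → suc a < n → PlaysBelow π w a (suc a)) where

  open Perm π

  greedy-mono : ∀ {p q} → p < q → q < n → greedy w p ◁ greedy w q
  greedy-mono = step⇒mono {R = _◁_} ◁-trans (greedy w) (λ {p} _ → greedy-◁ w p)

  embedding : (∀ {p} → p < n → run (greedy w p) < n) → Embedding π
  embedding run< = record
    { cell   = greedy w
    ; inGrid = λ {p} p<n → ∈-zigzag n (greedy-parity w p) (run< p<n)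
                 (subst (_< n) (sym (greedy-letter w p)) (w< p<n))
    ; ◁-step = λ {p} _ → greedy-◁ w p
    ; ≺-step = ≺-step
    }
    where
    ≺-step : ∀ {a} → suc a < n → greedy w (pos a) ≺ greedy w (pos (suc a))
    ≺-step {a} 1+a<n with w-step 1+a<n
    ... | inj₁ lt = inj₁ (subst₂ _<_ (sym (greedy-letter w _)) (sym (greedy-letter w _)) lt)
    ... | inj₂ (e , gt) = inj₂ (e′ , ◁-sameLetter (sym e′) (greedy-mono gt (pos< (<-trans ≤-refl 1+a<n))))
      where
      e′ = trans (greedy-letter w _) (trans e (sym (greedy-letter w _)))

-- Sharing one letter between a + 1 and a distant later a

merge : ℕ → ℕ → ℕ
merge a v with v ≤? a
... | yes _ = v
... | no  _ = pred v

merge-≤ : ∀ {a v} → v ≤ a → merge a v ≡ v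
merge-≤ {a} {v} v≤a with v ≤? a
... | yes _  = refl
... | no v≰a = contradiction v≤a v≰a

merge-> : ∀ {a v} → a < v → merge a v ≡ pred v
merge-> {a} {v} a<v with v ≤? a
... | yes v≤a = contradiction v≤a (<⇒≱ a<v)
... | no  _   = refl

merge-mono : ∀ a {u v} → u < v → merge a u < merge a v ⊎ (u ≡ a × v ≡ suc a)
merge-mono a {u} {v} u<v with <-cmp u a | m≤n⇒m<n∨m≡n u<v
... | tri> _ _ a<u | _ = inj₁ (subst₂ _<_ (sym (merge-> a<u)) (sym (merge-> (<-trans a<u u<v)))
    (pred-mono-< {{>-nonZero (m<n⇒0<n a<u)}} u<v))
... | tri≈ _ refl _ | inj₂ refl = inj₂ (refl , refl)
... | tri≈ _ refl _ | inj₁ 1+u<v = inj₁ (subst₂ _<_ (sym (merge-≤ {u} ≤-refl)) (sym (merge-> u<v))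
    (pred-mono-< 1+u<v))
... | tri< u<a _ _ | _ with v ≤? a
...   | yes v≤a = inj₁ (subst (_< v) (sym (merge-≤ (<⇒≤ u<a))) u<v)
...   | no  v≰a = inj₁ (subst (_< pred v) (sym (merge-≤ (<⇒≤ u<a)))
                    (<-≤-trans u<a (pred-mono-≤ (≰⇒> v≰a))))

module Distant {m} (π : Perm (suc m)) (a : ℕ) (a<m : a < m)
  (distant : suc (Perm.pos π (suc a)) < Perm.pos π a) where

  open Perm π

  n : ℕ
  n = suc m

  w : ℕ → ℕ
  w p = merge a (at p)

  -- Sharing frees one letter, so that the shifted word `suc ∘ w` has its letters below `n` too.
  merge-bounded : ∀ {v} → v < n → merge a v < m
  merge-bounded {v} v<n with v ≤? a
  ... | yes v≤a = ≤-<-trans v≤a a<m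
  ... | no  v≰a = pred-mono-< {{>-nonZero (m<n⇒0<n (≰⇒> v≰a))}} v<n

  w-step : ∀ {b} → suc b < n → PlaysBelow π w b (suc b)
  w-step {b} 1+b<n with at-pos (<-trans ≤-refl 1+b<n) | at-pos 1+b<n | merge-mono a {b} {suc b} ≤-refl
  ... | e₁ | e₂ | inj₁ lt = inj₁ (subst₂ (λ x y → merge a x < merge a y) (sym e₁) (sym e₂) lt)
  ... | e₁ | e₂ | inj₂ (refl , _) = inj₂
    ( trans (cong (merge a) e₁) (trans (merge-≤ {a} ≤-refl) (sym (trans (cong (merge a) e₂) (merge-> {a} ≤-refl))))
    , <-trans ≤-refl distant )

  -- Only `a` and `a + 1` share a letter, and `distant` keeps them from being neighbours in either
  -- order.
  w-norepeat : ∀ {p} → p < m → w p ≢ w (suc p)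
  w-norepeat {p} p<m e with <-cmp (at p) (at (suc p))
  ... | tri≈ _ e′ _ = contradiction
    (trans (sym (pos-at (m<n⇒m<1+n p<m))) (trans (cong pos e′) (pos-at (s<s p<m)))) (<⇒≢ ≤-refl)
  ... | tri< lt _ _ with merge-mono a lt
  ...   | inj₁ lt′ = contradiction e (<⇒≢ lt′)
  ...   | inj₂ (e₁ , e₂) = contradiction (subst₂ (λ x y → suc x < y)
            (trans (cong pos (sym e₂)) (pos-at (s<s p<m))) (trans (cong pos (sym e₁)) (pos-at (m<n⇒m<1+n p<m))) distant)
            (≤⇒≯ (m≤n+m p 2))
  w-norepeat {p} p<m e | tri> _ _ gt with merge-mono a gt
  ...   | inj₁ lt′ = contradiction (sym e) (<⇒≢ lt′)
  ...   | inj₂ (e₁ , e₂) = contradiction (subst₂ (λ x y → suc x < y)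
            (trans (cong pos (sym e₂)) (pos-at (m<n⇒m<1+n p<m))) (trans (cong pos (sym e₁)) (pos-at (s<s p<m))) distant)
            (<-irrefl refl)

  embedding : Embedding π
  -- The last runs of `w` and of its shift add up to 2m + 1, so one of them is at most `m`, the
  -- index of the final run. Earlier cells lie in no later run.
  embedding with run (greedy w m) ≤? m
  ... | yes r≤m = G.embedding λ p<n → ≤-<-trans (last-max p<n) (s<s r≤m)
    where
    module G = Greedy π w (m<n⇒m<1+n ∘ merge-bounded ∘ at<) w-step
    last-max : ∀ {p} → p < n → run (greedy w p) ≤ run (greedy w m)
    last-max {p} p<n with m≤n⇒m<n∨m≡n (s≤s⁻¹ p<n)
    ... | inj₁ p<m  = ◁⇒run≤ (G.greedy-mono p<m ≤-refl)
    ... | inj₂ refl = ≤-refl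
  ... | no r≰m = G.embedding λ p<n → ≤-<-trans (last-max p<n) (s<s r′≤m)
    where
    module G = Greedy π (suc ∘ w) (s<s ∘ merge-bounded ∘ at<)
      (λ b<n → [ inj₁ ∘ s<s , (λ (e , lt) → inj₂ (cong suc e , lt)) ]′ (w-step b<n))
    last-max : ∀ {p} → p < n → run (greedy (suc ∘ w) p) ≤ run (greedy (suc ∘ w) m)
    last-max {p} p<n with m≤n⇒m<n∨m≡n (s≤s⁻¹ p<n)
    ... | inj₁ p<m  = ◁⇒run≤ (G.greedy-mono p<m ≤-refl)
    ... | inj₂ refl = ≤-refl
    r′≤m : run (greedy (suc ∘ w) m) ≤ m
    r′≤m = ≮⇒≥ λ m<r′ → <⇒≱ (s≤s (+-monoʳ-< m (≤-refl {suc m})))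
      (subst (suc m + suc m ≤_) (greedy+greedy w m w-norepeat) (+-mono-≤ (≰⇒> r≰m) m<r′))

-- Layered permutations

parity-suc′ : ∀ {n p} → parity n ≡ p → parity (suc n) ≡ p ⁻¹
parity-suc′ {n} e = trans (parity-suc n) (cong _⁻¹ e)

parity-pred : ∀ {n p} → parity (suc n) ≡ p → parity n ≡ p ⁻¹
parity-pred {n} e = trans (sym (suc-homo-⁻¹ n)) (cong _⁻¹ e)

parity-+ : ∀ {m n p q} → parity m ≡ p → parity n ≡ q → parity (m + n) ≡ p ℙ.+ q
parity-+ {m} {n} e f = trans (+-homo-+ m n) (cong₂ ℙ._+_ e f)

parity-cancelˡ : ∀ {m n p} → parity m ≡ 0ℙ → parity (m + n) ≡ p → parity n ≡ p
parity-cancelˡ {m} {n} e f = trans (sym (parity-+ {m} {n} e refl)) f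

odd⇒suc : ∀ n → parity n ≡ 1ℙ → ∃ λ m → n ≡ suc m × parity m ≡ 0ℙ
odd⇒suc (suc m) e = m , refl , parity-pred {m} e

parity-+-double : ∀ m d → parity (m + (d + d)) ≡ parity m
parity-+-double m d = trans (cong parity (+-comm m (d + d))) (parity-+ {d + d} (parity-double d) refl)

≤⇒∃ : ∀ {m n} → m ≤ n → ∃ λ o → n ≡ m + o
≤⇒∃ m≤n = let o , e = m≤n⇒∃[o]m+o≡n m≤n in o , sym e

-- A decreasing layer placed in consecutive runs; from its h-th entry on, all
-- entries share the letter b and use every other run.
block : ℕ → ℕ → ℕ → ℕ → Cell
block ρ b h i = ρ + i + (i ∸ h) , b + (h ∸ i)

module _ (ρ b h : ℕ) where

  -- Up to entry `h` each step moves run and letter by one; afterwards the run moves by two and the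
  -- letter rests. Agreement at the first entry therefore persists.
  block-parity : parity ρ ≡ parity (b + h) → ∀ i →
    parity (run (block ρ b h i)) ≡ parity (letter (block ρ b h i))
  block-parity e i with ≤-total i h
  ... | inj₁ i≤h with ≤⇒∃ i≤h
  ...   | j , refl = begin
    parity (ρ + i + (i ∸ (i + j)))  ≡⟨ cong parity (trans (cong (ρ + i +_) (m≤n⇒m∸n≡0 i≤h)) (+-identityʳ _)) ⟩
    parity (ρ + i)                  ≡⟨ parity-+ {ρ} {i} e refl ⟩
    parity (b + (i + j)) ℙ.+ parity i ≡⟨ +-homo-+ (b + (i + j)) i ⟨
    parity (b + (i + j) + i)        ≡⟨ cong parity (solve 3 (λ b i j → b :+ (i :+ j) :+ i := b :+ j :+ (i :+ i)) refl b i j) ⟩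
    parity (b + j + (i + i))        ≡⟨ parity-+-double (b + j) i ⟩
    parity (b + j)                  ≡⟨ cong (λ x → parity (b + x)) (m+n∸m≡n i j) ⟨
    parity (b + (i + j ∸ i))        ∎
    where open ≡-Reasoning
          open +-*-Solver
  block-parity e i | inj₂ h≤i with ≤⇒∃ h≤i
  ...   | j , refl = begin
    parity (ρ + (h + j) + (h + j ∸ h)) ≡⟨ cong (λ x → parity (ρ + (h + j) + x)) (m+n∸m≡n h j) ⟩
    parity (ρ + (h + j) + j)        ≡⟨ cong parity (solve 3 (λ r h j → r :+ (h :+ j) :+ j := r :+ h :+ (j :+ j)) refl ρ h j) ⟩
    parity (ρ + h + (j + j))        ≡⟨ parity-+-double (ρ + h) j ⟩
    parity (ρ + h)                  ≡⟨ parity-+ {ρ} {h} e refl ⟩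
    parity (b + h) ℙ.+ parity h     ≡⟨ +-homo-+ (b + h) h ⟨
    parity (b + h + h)              ≡⟨ cong parity (+-assoc b h h) ⟩
    parity (b + (h + h))            ≡⟨ parity-+-double b h ⟩
    parity b                        ≡⟨ cong parity (trans (cong (b +_) (m≤n⇒m∸n≡0 h≤i)) (+-identityʳ _)) ⟨
    parity (b + (h ∸ (h + j)))      ∎
    where open ≡-Reasoning
          open +-*-Solver

  block-run-mono : ∀ {i j} → i ≤ j → run (block ρ b h i) ≤ run (block ρ b h j)
  block-run-mono i≤j = +-mono-≤ (+-monoʳ-≤ ρ i≤j) (∸-monoˡ-≤ h i≤j)

  block-run-< : ∀ i → run (block ρ b h i) < run (block ρ b h (suc i))
  block-run-< i = +-mono-<-≤ (+-monoʳ-< ρ ≤-refl) (∸-monoˡ-≤ h (n≤1+n i))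

  block-≺ : ∀ i → block ρ b h (suc i) ≺ block ρ b h i
  block-≺ i with i <? h
  ... | yes i<h = inj₁ (+-monoʳ-< b (∸-monoʳ-< ≤-refl i<h))
  ... | no  i≮h = inj₂ (cong (b +_) (trans (m≤n⇒m∸n≡0 (m≤n⇒m≤1+n h≤i)) (sym (m≤n⇒m∸n≡0 h≤i))) , block-run-< i)
    where h≤i = ≮⇒≥ i≮h

  ρ≤block-run : ∀ i → ρ ≤ run (block ρ b h i)
  ρ≤block-run i = ≤-trans (m≤m+n ρ i) (m≤m+n (ρ + i) (i ∸ h))

  b≤block-letter : ∀ i → b ≤ letter (block ρ b h i)
  b≤block-letter i = m≤m+n b (h ∸ i)

  block-letter≤ : ∀ i → letter (block ρ b h i) ≤ b + h
  block-letter≤ i = +-monoʳ-≤ b (m∸n≤m h i)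

-- Rounding down to an even number. It serves as a bound on runs: an even run ascends, so a further
-- layer with larger letters may still begin in it.
EvenFloor : ℕ → ℕ → Set
EvenFloor s M = parity M ≡ 0ℙ × (s ≡ M ⊎ s ≡ suc M)

evenFloor : ∀ s → ∃ (EvenFloor s)
evenFloor zero = 0 , refl , inj₁ refl
evenFloor (suc s) with parity s in e
... | 0ℙ = s , e , inj₂ refl
... | 1ℙ = suc s , parity-suc′ {s} e , inj₁ refl

EvenFloor-pred≤ : ∀ {s M} → EvenFloor (suc s) M → s ≤ M
EvenFloor-pred≤ (_ , inj₁ refl) = n≤1+n _
EvenFloor-pred≤ (_ , inj₂ refl) = ≤-refl

-- This concerns the last run of a block with `h = k`, where no letter is shared.
fullRun≤ : ∀ ρ k {M} → ρ + k ≤ M → ρ + k + (k ∸ k) ≤ M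
fullRun≤ ρ k le rewrite n∸n≡0 k | +-identityʳ (ρ + k) = le

-- Decomposition into decreasing layers

module Layers {n} (π : Perm n)
  (close : ∀ {a} → suc a < n → Perm.pos π a ≤ suc (Perm.pos π (suc a))) where

  open Perm π

  -- The layer has k + 1 entries, so its length is odd exactly when `k` is even.
  Layer : ℕ → ℕ → Set
  Layer s k = s + k < n × (∀ {i} → i ≤ k → at (s + i) ≡ s + (k ∸ i))

  data Layered : ℕ → Set where
    []  : Layered 0
    _▷_ : ∀ {s k t} → Layered s → Layer s k × t ≡ suc (s + k) → Layered t

  layer-pos : ∀ {s k} → Layer s k → ∀ {j} → j ≤ k → pos (s + j) ≡ s + (k ∸ j)
  layer-pos {s} {k} (s+k<n , dec) {j} j≤k = begin
    pos (s + j)              ≡⟨ cong (λ x → pos (s + x)) (m∸[m∸n]≡n j≤k) ⟨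
    pos (s + (k ∸ (k ∸ j)))  ≡⟨ cong pos (dec (m∸n≤m k j)) ⟨
    pos (at (s + (k ∸ j)))   ≡⟨ pos-at (≤-<-trans (+-monoʳ-≤ s (m∸n≤m k j)) s+k<n) ⟩
    s + (k ∸ j)              ∎
    where open ≡-Reasoning

  split : ∀ s k {p} → p < suc (s + k) → p < s ⊎ ∃ λ i → i ≤ k × p ≡ s + i
  split s k {p} p<t with p <? s
  ... | yes p<s = inj₁ p<s
  ... | no  p≮s with ≤⇒∃ (≮⇒≥ p≮s)
  ...   | i , refl = inj₂ (i , +-cancelˡ-≤ s i k (s≤s⁻¹ p<t) , refl)

  module _ {s k} (L : Layer s k) where

    layer-at< : (∀ {p} → p < s → at p < s) → ∀ {p} → p < suc (s + k) → at p < suc (s + k)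
    layer-at< at<s p<t with split s k p<t
    ... | inj₁ p<s = <-≤-trans (at<s p<s) (m≤n⇒m≤1+n (m≤m+n s k))
    ... | inj₂ (i , i≤k , refl) = subst (_< suc (s + k)) (sym (proj₂ L i≤k)) (s<s (+-monoʳ-≤ s (m∸n≤m k i)))

    layer-pos< : (∀ {a} → a < s → pos a < s) → ∀ {a} → a < suc (s + k) → pos a < suc (s + k)
    layer-pos< pos<s a<t with split s k a<t
    ... | inj₁ a<s = <-≤-trans (pos<s a<s) (m≤n⇒m≤1+n (m≤m+n s k))
    ... | inj₂ (i , i≤k , refl) = subst (_< suc (s + k)) (sym (layer-pos L i≤k)) (s<s (+-monoʳ-≤ s (m∸n≤m k i)))

  Layered-at< : ∀ {s} → Layered s → ∀ {p} → p < s → at p < s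
  Layered-at< (Ls ▷ (L , refl)) = layer-at< L (Layered-at< Ls)

  Layered-pos< : ∀ {s} → Layered s → ∀ {a} → a < s → pos a < s
  Layered-pos< (Ls ▷ (L , refl)) = layer-pos< L (Layered-pos< Ls)

  -- The letter at position `s` is some s + k and fixes the length; the letters below it, down to
  -- `s`, are then forced to follow one by one.
  nextLayer : ∀ {s} → Layered s → s < n → ∃ (Layer s)
  nextLayer {s} Ls s<n = k , s+k<n , λ {i} i≤k → dec i ≤-refl i≤k
    where
    s≤at : s ≤ at s
    -- A letter below `s` has its position inside the earlier layers.
    s≤at = ≮⇒≥ λ lt → <-irrefl (pos-at s<n) (Layered-pos< Ls lt)

    k = proj₁ (≤⇒∃ s≤at)

    at-s : at s ≡ s + k
    at-s = proj₂ (≤⇒∃ s≤at)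

    s+k<n : s + k < n
    s+k<n = subst (_< n) at-s (at< s<n)

    dec : ∀ i {i′} → i′ ≤ i → i′ ≤ k → at (s + i′) ≡ s + (k ∸ i′)
    dec zero    z≤n  _   = trans (cong at (+-identityʳ s)) at-s
    dec (suc i) i′≤1+i i′≤k with m≤n⇒m<n∨m≡n i′≤1+i
    ... | inj₁ i′<1+i = dec i (s≤s⁻¹ i′<1+i) i′≤k
    ... | inj₂ refl   = trans (cong at (sym pos-a)) (at-pos a<n)
      where
      a = s + (k ∸ suc i)

      1+a≡ : suc a ≡ s + (k ∸ i)
      1+a≡ = trans (sym (+-suc s _)) (cong (s +_) (sym (+-∸-assoc 1 i′≤k)))

      1+a<n : suc a < n
      1+a<n = subst (_< n) (sym 1+a≡) (≤-<-trans (+-monoʳ-≤ s (m∸n≤m k i)) s+k<n)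

      a<n : a < n
      a<n = <-trans ≤-refl 1+a<n

      pos-1+a : pos (suc a) ≡ s + i
      pos-1+a = trans (cong pos (trans 1+a≡ (sym (dec i ≤-refl (<⇒≤ i′≤k)))))
        (pos-at (≤-<-trans (+-monoʳ-≤ s (<⇒≤ i′≤k)) s+k<n))

      -- `close` leaves the next position or an earlier one, but the earlier ones hold letters below
      -- `s` or larger letters of this layer.
      pos-a : pos a ≡ s + suc i
      pos-a with m≤n⇒m<n∨m≡n (subst (λ x → pos a ≤ suc x) pos-1+a (close 1+a<n))
      ... | inj₂ e  = trans e (sym (+-suc s i))
      ... | inj₁ lt with split s i lt
      ...   | inj₁ pos<s = contradiction (subst (_< s) (at-pos a<n) (Layered-at< Ls pos<s)) (≤⇒≯ (m≤m+n s _))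
      ...   | inj₂ (j , j≤i , e) = contradiction
              (+-cancelˡ-≡ s (k ∸ suc i) (k ∸ j)
                (trans (sym (at-pos a<n)) (trans (cong at e) (dec i j≤i (≤-trans j≤i (<⇒≤ i′≤k))))))
              (<⇒≢ (∸-monoʳ-< (s≤s j≤i) i′≤k))

  layered : Layered n
  layered = go n [] z≤n ≤-refl
    where
    -- `d` is fuel bounding the number of positions still to be covered.
    go : ∀ d {s} → Layered s → s ≤ n → n ≤ s + d → Layered n
    go zero    {s} Ls s≤n n≤s = subst Layered (≤-antisym s≤n (subst (n ≤_) (+-identityʳ s) n≤s)) Ls
    go (suc d) {s} Ls s≤n n≤s+d with m≤n⇒m<n∨m≡n s≤n
    ... | inj₂ refl = Ls
    ... | inj₁ s<n with nextLayer Ls s<n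
    ...   | k , L@(s+k<n , _) = go d (Ls ▷ (L , refl)) s+k<n
            (≤-trans n≤s+d (≤-trans (≤-reflexive (+-suc s d)) (s≤s (+-monoˡ-≤ d (m≤m+n s k)))))

  -- Embedding layer after layer

  record Prefix (t M b : ℕ) : Set where
    field
      cell    : ℕ → Cell
      run≤    : ∀ {p} → p < t → run (cell p) ≤ M
      letter< : ∀ {p} → p < t → letter (cell p) < b
      parity≡ : ∀ {p} → p < t → parity (run (cell p)) ≡ parity (letter (cell p))
      ◁-step  : ∀ {p} → suc p < t → cell p ◁ cell (suc p)
      ≺-step  : ∀ {a} → suc a < t → cell (pos a) ≺ cell (pos (suc a))

  empty : Prefix 0 0 0
  empty = record
    { cell = λ _ → 0 , 0 ; run≤ = λ () ; letter< = λ () ; parity≡ = λ () ; ◁-step = λ () ; ≺-step = λ () }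

  weaken : ∀ {t M M′ b} → M ≤ M′ → Prefix t M b → Prefix t M′ b
  weaken M≤M′ P = record { Prefix P hiding (run≤) ; run≤ = λ p<t → ≤-trans (Prefix.run≤ P p<t) M≤M′ }

  -- The new layer becomes a block whose first letter is b′ + h, so `ρ-parity` is the agreement of
  -- run and letter at its first entry.
  module Append {s k M b} (Ls : Layered s) (L : Layer s k) (P : Prefix s M b) (M-even : parity M ≡ 0ℙ)
    {ρ b′ h} (M≤ρ : M ≤ ρ) (b≤b′ : b ≤ b′) (ρ-parity : parity ρ ≡ parity (b′ + h)) where

    module P = Prefix P

    cell : ℕ → Cell
    cell p with p <? s
    ... | yes _ = P.cell p
    ... | no  _ = block ρ b′ h (p ∸ s)

    cell-old : ∀ {p} → p < s → cell p ≡ P.cell p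
    cell-old {p} p<s with p <? s
    ... | yes _   = refl
    ... | no  p≮s = contradiction p<s p≮s

    cell-new : ∀ i → cell (s + i) ≡ block ρ b′ h i
    cell-new i with s + i <? s
    ... | yes lt = contradiction lt (m+n≮m s i)
    ... | no  _  = cong (block ρ b′ h) (m+n∸m≡n s i)

    ∀cell : (Q : Cell → Set) → (∀ {p} → p < s → Q (P.cell p)) → (∀ {i} → i ≤ k → Q (block ρ b′ h i)) →
      ∀ {p} → p < suc (s + k) → Q (cell p)
    ∀cell Q old new p<t with split s k p<t
    ... | inj₁ p<s = subst Q (sym (cell-old p<s)) (old p<s)
    ... | inj₂ (i , i≤k , refl) = subst Q (sym (cell-new i)) (new i≤k)

    -- If the two cells lie in the same run, it must be run `M`, which is even and ascends, and the
    -- new letters are larger.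
    old-◁-new : ∀ {p} i → p < s → P.cell p ◁ block ρ b′ h i
    old-◁-new {p} i p<s with m≤n⇒m<n∨m≡n (≤-trans (P.run≤ p<s) (≤-trans M≤ρ (ρ≤block-run ρ b′ h i)))
    ... | inj₁ lt = inj₁ lt
    ... | inj₂ e  = inj₂ (e , subst (λ q → Ascends q (letter (P.cell p)) (letter (block ρ b′ h i))) (sym even)
                              (<-≤-trans (P.letter< p<s) (≤-trans b≤b′ (b≤block-letter ρ b′ h i))))
      where
      even : parity (run (P.cell p)) ≡ 0ℙ
      even = trans (cong parity (≤-antisym (P.run≤ p<s)
        (≤-trans M≤ρ (≤-trans (ρ≤block-run ρ b′ h i) (≤-reflexive (sym e)))))) M-even

    old-≺-new : ∀ {p} i → p < s → P.cell p ≺ block ρ b′ h i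
    old-≺-new i p<s = inj₁ (<-≤-trans (P.letter< p<s) (≤-trans b≤b′ (b≤block-letter ρ b′ h i)))

    ◁-step : ∀ {p} → suc p < suc (s + k) → cell p ◁ cell (suc p)
    ◁-step {p} 1+p<t with split s k 1+p<t
    ... | inj₁ 1+p<s = subst₂ _◁_ (sym (cell-old (<-trans ≤-refl 1+p<s))) (sym (cell-old 1+p<s)) (P.◁-step 1+p<s)
    ... | inj₂ (zero , _ , e) = subst₂ _◁_ (sym (cell-old p<s))
            (trans (sym (cell-new 0)) (cong cell (sym e))) (old-◁-new 0 p<s)
      where
      p<s : p < s
      p<s = ≤-reflexive (trans e (+-identityʳ s))
    ... | inj₂ (suc i , _ , e) rewrite suc-injective (trans e (+-suc s i)) =
      subst₂ _◁_ (sym (cell-new i)) (trans (sym (cell-new (suc i))) (cong cell (+-suc s i)))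
        (inj₁ (block-run-< ρ b′ h i))

    ≺-step : ∀ {a} → suc a < suc (s + k) → cell (pos a) ≺ cell (pos (suc a))
    ≺-step {a} 1+a<t with split s k 1+a<t
    ... | inj₁ 1+a<s = subst₂ _≺_ (sym (cell-old (Layered-pos< Ls (<-trans ≤-refl 1+a<s))))
                         (sym (cell-old (Layered-pos< Ls 1+a<s))) (P.≺-step 1+a<s)
    ... | inj₂ (zero , _ , e) = subst₂ _≺_ (sym (cell-old pos<s))
            (sym (trans (cong cell (trans (cong pos e) (layer-pos L z≤n))) (cell-new k)))
            (old-≺-new k pos<s)
      where
      pos<s : pos a < s
      pos<s = Layered-pos< Ls (≤-reflexive (trans e (+-identityʳ s)))
    ... | inj₂ (suc i , i<k , e) rewrite suc-injective (trans e (+-suc s i)) = subst₂ _≺_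
            (sym (trans (cong cell (trans (layer-pos L (<⇒≤ i<k)) (cong (s +_) (+-∸-assoc 1 i<k))))
                        (cell-new (suc (k ∸ suc i)))))
            (sym (trans (cong cell (trans (cong pos (sym (+-suc s i))) (layer-pos L i<k)))
                        (cell-new (k ∸ suc i))))
            (block-≺ ρ b′ h (k ∸ suc i))

    prefix : Prefix (suc (s + k)) (ρ + k + (k ∸ h)) (suc (b′ + h))
    prefix = record
      { cell    = cell
      ; run≤    = ∀cell (λ x → run x ≤ _)
          (λ p<s → ≤-trans (P.run≤ p<s) (≤-trans M≤ρ (ρ≤block-run ρ b′ h k))) (block-run-mono ρ b′ h)
      ; letter< = ∀cell (λ x → letter x < _)
          (λ p<s → <-≤-trans (P.letter< p<s) (≤-trans b≤b′ (m≤n⇒m≤1+n (m≤m+n b′ h))))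
          (λ {i} _ → s<s (block-letter≤ ρ b′ h i))
      ; parity≡ = ∀cell (λ x → parity (run x) ≡ parity (letter x)) P.parity≡ (λ {i} _ → block-parity ρ b′ h ρ-parity i)
      ; ◁-step  = ◁-step
      ; ≺-step  = ≺-step
      }

  -- Every entry keeps its own letter. The run equals the position on layers of odd length and is
  -- off by one on the others. It is one more only after an even start; then the end is even as
  -- well, and rounding it down loses nothing.
  plain : ∀ {s M} → Layered s → EvenFloor s M → Prefix s M s
  plain [] (_ , inj₁ refl) = empty
  plain {M = M′} (_▷_ {s} {k} Ls (L , refl)) M′-floor with evenFloor s | parity k in k-parity
  ... | M , M-even , inj₁ refl | 0ℙ = weaken (fullRun≤ M k (EvenFloor-pred≤ {M + k} M′-floor))
    (Append.prefix Ls L (plain Ls (M-even , inj₁ refl)) M-even {M} {M} {k} ≤-refl ≤-refl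
      (trans M-even (sym (parity-+ {M} M-even k-parity))))
  ... | M , M-even , inj₂ refl | 0ℙ = weaken (fullRun≤ (suc M) k (EvenFloor-pred≤ {suc M + k} M′-floor))
    (Append.prefix Ls L (plain Ls (M-even , inj₂ refl)) M-even {suc M} {suc M} {k} (n≤1+n M) ≤-refl
      (trans (parity-suc′ {M} M-even) (sym (parity-+ {suc M} (parity-suc′ {M} M-even) k-parity))))
  ... | M , M-even , inj₂ refl | 1ℙ = weaken (fullRun≤ M k (≤-trans (n≤1+n (M + k)) (EvenFloor-pred≤ {suc M + k} M′-floor)))
    (Append.prefix Ls L (plain Ls (M-even , inj₂ refl)) M-even {M} {suc M} {k} ≤-refl ≤-refl
      (trans M-even (sym (parity-+ {suc M} (parity-suc′ {M} M-even) k-parity))))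
  ... | M , M-even , inj₁ refl | 1ℙ = weaken (fullRun≤ (suc M) k (t≤M′ M′-floor))
    (Append.prefix Ls L (plain Ls (M-even , inj₁ refl)) M-even {suc M} {M} {k} (n≤1+n M) ≤-refl
      (trans (parity-suc′ {M} M-even) (sym (parity-+ {M} M-even k-parity))))
    where
    t≤M′ : EvenFloor (suc (M + k)) M′ → suc (M + k) ≤ M′
    t≤M′ (_ , inj₁ e) = ≤-reflexive e
    t≤M′ (M′-even , inj₂ e) = contradiction
      (trans (sym (parity-+ {M} M-even k-parity)) (trans (cong parity (suc-injective e)) M′-even)) λ ()

  -- The last layers

  fromPrefix : ∀ {M b} (P : Prefix n M b) → (∀ {p} → p < n → Prefix.cell P p ∈ zigzag n) → Embedding π
  fromPrefix P mem = record { Prefix P using (cell; ◁-step; ≺-step) ; inGrid = mem }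

  -- Below `n`, agreement of parities is all that membership in the zigzag takes, which is why a
  -- prefix records only parities and bounds.
  fromSmallPrefix : ∀ {M b} → M < n → b ≤ n → Prefix n M b → Embedding π
  fromSmallPrefix M<n b≤n P = fromPrefix P λ p<n →
    ∈-zigzag n (P.parity≡ p<n) (≤-<-trans (P.run≤ p<n) M<n) (<-≤-trans (P.letter< p<n) b≤n)
    where module P = Prefix P

  -- The first letter `k` is odd, so the layer has to start in run 1. Its entries then fill runs 1
  -- to n, and the final 0 lands on the appended cell.
  fromDecreasing : ∀ {k} → Layer 0 k → n ≡ suc k → parity n ≡ 0ℙ → Embedding π
  fromDecreasing {k} L refl n-even = fromPrefix A.prefix (A.∀cell (_∈ zigzag n) (λ ()) mem)
    where
    module A = Append [] L empty refl {1} {0} {k} z≤n z≤n (sym (parity-pred {k} n-even))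
    mem : ∀ {i} → i ≤ k → block 1 0 k i ∈ zigzag n
    mem {i} i≤k with m≤n⇒m<n∨m≡n i≤k
    ... | inj₂ refl rewrite n∸n≡0 k | +-identityʳ k = extra∈zigzag n n-even
    ... | inj₁ i<k = ∈-zigzag n (block-parity 1 0 k (sym (parity-pred {k} n-even)) i)
      (subst (_< n) (sym (trans (cong (suc i +_) (m≤n⇒m∸n≡0 i≤k)) (+-identityʳ (suc i)))) (s<s i<k))
      (s≤s (m∸n≤m k i))

  -- Here `plain` would bound the runs only by `n`. The last layer has odd length, so its runs are
  -- its positions and end at n - 1.
  fromOddLastStart : ∀ {M k} → Layered (suc M) → Layer (suc M) k → parity M ≡ 0ℙ → parity k ≡ 0ℙ →
    n ≡ suc (suc M + k) → Embedding π
  fromOddLastStart {M} {k} Ls L M-even k-even refl = fromSmallPrefix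
    (s≤s (fullRun≤ (suc M) k ≤-refl)) ≤-refl
    (Append.prefix Ls L (plain Ls (M-even , inj₂ refl)) M-even {suc M} {suc M} {k} (n≤1+n M) ≤-refl
      (trans (parity-suc′ {M} M-even) (sym (parity-+ {suc M} (parity-suc′ {M} M-even) k-even))))

  -- Sharing the least two letters of the last but one layer lets both last
  -- layers start in the run numbered by their position.
  fromEvenPrevStart : ∀ {q j k} → Layered q → Layer q (suc j) → Layer (suc (q + suc j)) k →
    parity q ≡ 0ℙ → parity j ≡ 0ℙ → parity k ≡ 1ℙ → n ≡ suc (suc (q + suc j) + k) → Embedding π
  fromEvenPrevStart {q} {j} {k} Ls L′ L q-even j-even k-odd refl = fromSmallPrefix
    (s≤s (fullRun≤ s k ≤-refl)) (s≤s (+-monoˡ-≤ k (n≤1+n b)))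
    (Append.prefix (Ls ▷ (L′ , refl)) L P s-even {s} {b} {k} ≤-refl
      (≤-reflexive (sym (+-suc q j))) (trans s-even (sym (parity-+ {b} b-odd k-odd))))
    where
    b = q + suc j
    s = suc b

    b-odd : parity b ≡ 1ℙ
    b-odd = parity-+ {q} q-even (parity-suc′ {j} j-even)

    s-even : parity s ≡ 0ℙ
    s-even = parity-suc′ {b} b-odd

    -- The second copy of the letter `q` comes two runs after the first, in the even run `s`, where
    -- the last layer can begin as well.
    P : Prefix s s (suc (q + j))
    P = weaken (≤-reflexive (trans (cong (b +_) (m+n∸n≡m 1 j)) (+-comm b 1)))
      (Append.prefix Ls L′ (plain Ls (q-even , inj₁ refl)) q-even {q} {q} {j} ≤-refl ≤-refl
        (trans q-even (sym (parity-+ {q} q-even j-even))))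

  -- Sharing the least two letters of the last layer frees a letter, which is
  -- skipped just before the last but one layer; from there on all runs but the
  -- final one drop to one below the position.
  fromOddPrevStart : ∀ {q j k} → Layered (suc q) → Layer (suc q) j → Layer (suc (suc q + j)) (suc k) →
    parity q ≡ 0ℙ → parity j ≡ 0ℙ → parity k ≡ 0ℙ → n ≡ suc (suc (suc q + j) + suc k) → Embedding π
  fromOddPrevStart {q} {j} {k} Ls L′ L q-even j-even k-even refl = fromSmallPrefix
    (≤-reflexive (cong suc run≡)) (≤-reflexive (cong suc (sym (+-suc s k))))
    (Append.prefix (Ls ▷ (L′ , refl)) L P (parity-+ {q} q-even j-even) {suc q + j} {suc s} {k}
      (n≤1+n (q + j)) ≤-refl (trans (parity-suc′ {q + j} (parity-+ {q} q-even j-even))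
        (sym (parity-+ {suc s} (parity-suc′ {s} s-even) k-even))))
    where
    s = suc (suc q + j)

    s-even : parity s ≡ 0ℙ
    s-even = parity-+ {q} q-even j-even

    run≡ : suc q + j + suc k + (suc k ∸ k) ≡ s + suc k
    run≡ = trans (cong (suc q + j + suc k +_) (m+n∸n≡m 1 k)) (+-comm _ 1)

    -- The skipped letter is `suc q`. This makes the first letter of the layer even, so it fits into
    -- run `q`.
    P : Prefix s (q + j) (suc s)
    P = weaken (fullRun≤ q j ≤-refl)
      (Append.prefix Ls L′ (plain Ls (q-even , inj₂ refl)) q-even {q} {suc (suc q)} {j} ≤-refl (n≤1+n (suc q))
        (trans q-even (sym (parity-+ {suc (suc q)} q-even j-even))))

  -- For odd `n` the runs of `plain` end by n - 1. For even `n` a last layer starting at an odd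
  -- position has odd length; one starting at an even position has even length, and the parity of
  -- the start of the layer before it decides.
  embedding : Embedding π
  embedding with layered | evenFloor n
  ... | Ls | M , M-even , inj₂ e = fromSmallPrefix (≤-reflexive (sym e)) ≤-refl (plain Ls (M-even , inj₂ e))
  ... | [] | _ = record { cell = λ _ → 0 , 0 ; inGrid = λ () ; ◁-step = λ () ; ≺-step = λ () }
  ... | _▷_ {s} {k} Ls (L , n≡) | _ , n-even , inj₁ refl with evenFloor s
  ...   | M , M-even , inj₂ refl =
          fromOddLastStart Ls L M-even (parity-cancelˡ {M} M-even (trans (cong parity (sym n≡)) n-even)) n≡
  ...   | _ , s-even , inj₁ refl with Ls
           | odd⇒suc k (parity-cancelˡ {s} s-even (parity-pred {s + k} (trans (cong parity (sym n≡)) n-even)))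
  ...     | []                          | _ = fromDecreasing L n≡ n-even
  ...     | _▷_ {q} {j} Ls′ (L′ , refl) | k′ , refl , k′-even with evenFloor q
  ...       | M , M-even , inj₂ refl = fromOddPrevStart Ls′ L′ L M-even
                (parity-cancelˡ {M} M-even s-even) k′-even n≡
  ...       | _ , q-even , inj₁ refl with odd⇒suc j (parity-cancelˡ {q} q-even (parity-pred {q + j} s-even))
  ...         | j′ , refl , j′-even = fromEvenPrevStart Ls′ L′ L q-even j′-even (parity-suc′ {k′} k′-even) n≡

-- The universal permutation

everyPermEmbeds : ∀ {n} → n ≥ 1 → (π : Perm n) → Embedding π
everyPermEmbeds {suc m} _ π
  with anyUpTo? (λ a → suc (pos (suc a)) <? pos a) m
  where open Perm π
... | yes (a , a<m , distant) = Distant.embedding π a a<m distant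
... | no  none = Layers.embedding π λ 1+a<n → ≮⇒≥ λ distant → none (_ , s<s⁻¹ 1+a<n , distant)

theorem6p4 : ∀ (n : ℕ) → n ≥ 1 →
    (∃ λ (w : Word ⌈ n ^ 2 + 1 /2⌉) → ContainsAllPermutations n w)
    × (∃ λ (σ : Word ⌈ n ^ 2 + 1 /2⌉) → IsPermutation σ × ContainsAllPermutations n σ)
-- The standardised zigzag serves both claims, as a permutation is in particular a word.
theorem6p4 n n≥1 = (proj₁ universal , proj₂ (proj₂ universal)) , universal
  where
  open Standardisation (zigzag n) (zigzag-sorted n)
  universal : ∃ λ (σ : Word ⌈ n ^ 2 + 1 /2⌉) → IsPermutation σ × ContainsAllPermutations n σ
  universal = subst (λ k → ∃ λ (σ : Word k) → IsPermutation σ × ContainsAllPermutations n σ) (length-zigzag n)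
    (std , std-isPermutation , λ π π-perm →
      FromWord.contains π π-perm (everyPermEmbeds n≥1 (FromWord.perm π π-perm)))
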